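{- Let $G=(V,E)$ be an AT-free graph (finite, simple, connected, with no isolated vertices) and let $(x,y)$ be a dominating pair of $G$. For $0\le k\le l$ let $L_k=\{w\in V : d_G(x,w)=k\}$ be the BFS-levels of a BFS-tree of $G$ rooted at $x$, where $l$ is the largest distance from $x$. Then there exists a minimum cardinality paired dominating set $D_p$ of $G$ such that $\left| D_p \cap \bigcup_{k=i}^{i+j} L_k \right| \le j+4$ for all $i\in\{0,1,\ldots,l\}$ and all $j\in\{0,1,\ldots,l-i\}$.
   Context: For a graph $G=(V,E)$, a set $D\subseteq V$ is dominating if every vertex of $V\setminus D$ has a neighbour in $D$. For a graph with no isolated vertices, a paired dominating set is a dominating set $D$ such that $G[D]$ has a perfect matching. Three pairwise non-adjacent vertices form an asteroidal triple if for any two of them there is a path between them avoiding the closed neighbourhood of the third; a graph is AT-free if it has no asteroidal triple. A pair of vertices $(x,y)$ is a dominating pair if the vertex set of every path between $x$ and $y$ in $G$ is a dominating set of $G$. $d_G(x,w)$ denotes the length of a shortest $x$–$w$ path. -}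

module Defs where

open import Data.Nat using (ℕ; zero; suc; _≤_; _+_)
open import Data.Fin using (Fin)
open import Data.Bool using (Bool; true)
open import Data.List using (List; []; _∷_; length; head; last)
open import Data.Maybe using (just)
open import Data.List.Relation.Unary.All using (All)
open import Data.List.Relation.Unary.Any using (Any)
open import Data.List.Relation.Unary.Unique.Propositional using (Unique)
open import Data.Fin.Subset using (Subset; _∈_; _∉_; _⊆_; ∣_∣)
open import Data.Product using (Σ; ∃; _×_; _,_)
open import Data.Sum using (_⊎_)
open import Relation.Nullary using (¬_)
open import Relation.Binary.PropositionalEquality using (_≡_; _≢_)

record Graph (n : ℕ) : Set where
  field
    adj    : Fin n → Fin n → Bool
    sym    : ∀ u v → adj u v ≡ true → adj v u ≡ true
    irrefl : ∀ v → ¬ (adj v v ≡ true)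

module _ {n : ℕ} (G : Graph n) where
  open Graph G

  Adj : Fin n → Fin n → Set
  Adj u v = adj u v ≡ true

  InClosedNbhd : Fin n → Fin n → Set
  InClosedNbhd c v = v ≡ c ⊎ Adj c v

  Chain : List (Fin n) → Set
  Chain []           = ⊤'
    where open import Data.Unit using () renaming (⊤ to ⊤')
  Chain (_ ∷ [])     = ⊤'
    where open import Data.Unit using () renaming (⊤ to ⊤')
  Chain (u ∷ v ∷ vs) = Adj u v × Chain (v ∷ vs)

  record Path (a b : Fin n) : Set where
    field
      verts  : List (Fin n)
      start  : head verts ≡ just a
      end    : last verts ≡ just b
      chain  : Chain verts
      unique : Unique verts

  pathLength : ∀ {a b} → Path a b → ℕ
  pathLength p = length (Path.verts p) ∸' 1
    where open import Data.Nat using () renaming (_∸_ to _∸'_)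

  Connected : Set
  Connected = ∀ a b → Path a b

  NoIsolated : Set
  NoIsolated = ∀ v → ∃ λ u → Adj v u

  Dist : Fin n → Fin n → ℕ → Set
  Dist a b k = (Σ (Path a b) λ p → pathLength p ≡ k)
             × (∀ (p : Path a b) → k ≤ pathLength p)

  Ecc : Fin n → ℕ → Set
  Ecc x l = (∃ λ w → Dist x w l) × (∀ w k → Dist x w k → k ≤ l)

  AvoidingPath : Fin n → Fin n → Fin n → Set
  AvoidingPath a b c =
    Σ (Path a b) λ p → All (λ v → ¬ InClosedNbhd c v) (Path.verts p)

  AsteroidalTriple : Fin n → Fin n → Fin n → Set
  AsteroidalTriple a b c =
    a ≢ b × b ≢ c × a ≢ c
    × ¬ Adj a b × ¬ Adj b c × ¬ Adj a c
    × AvoidingPath a b c × AvoidingPath b c a × AvoidingPath a c b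

  ATFree : Set
  ATFree = ∀ a b c → ¬ AsteroidalTriple a b c

  Dominating : Subset n → Set
  Dominating D = ∀ v → v ∉ D → ∃ λ u → u ∈ D × Adj v u

  DominatingPair : Fin n → Fin n → Set
  DominatingPair x y =
    ∀ (p : Path x y) v → ∃ λ u → Any (u ≡_) (Path.verts p) × InClosedNbhd v u

  HasPerfectMatching : Subset n → Set
  HasPerfectMatching D =
    Σ (Fin n → Fin n) λ m →
      ∀ v → v ∈ D → (m v ∈ D) × Adj v (m v) × (m (m v) ≡ v)

  PairedDominating : Subset n → Set
  PairedDominating D = Dominating D × HasPerfectMatching D

  MinPairedDominating : Subset n → Set
  MinPairedDominating D =
    PairedDominating D × (∀ D' → PairedDominating D' → ∣ D ∣ ≤ ∣ D' ∣)

  -- |D ∩ (L_i ∪ … ∪ L_{i+j})| ≤ bound, stated as: every subset of D consisting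
  -- of vertices at distance in [i, i+j] from x has at most `bound` elements
  LevelBound : Fin n → Subset n → ℕ → ℕ → ℕ → Set
  LevelBound x D i j bound =
    ∀ (S : Subset n) → S ⊆ D →
      (∀ w → w ∈ S → ∃ λ k → Dist x w k × i ≤ k × k ≤ i + j) →
      ∣ S ∣ ≤ bound

{-# OPTIONS --safe #-}
module Submission where

-- Among the paired dominating sets D pick one that is minimum and, subject to that, contains as
-- many vertices as possible of a shortest x–y path f 0, …, f d, which is dominating by hypothesis.
-- Suppose that more than j + 4 vertices of D lie in levels i, …, i + j. Closing them under the
-- matching gives a set A ⊆ D of even size that lies in levels a, …, a + c, say, and still has at
-- least c + 5 elements. What A dominates lies in levels a − 1, …, a + c + 1 and so is dominated by
-- f (a − 2), …, f (a + c + 2), at most c + 5 vertices. Adding these to D ∖ A, two consecutive ones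
-- at a time, costs at most two vertices per pair, hence at most ∣ A ∣ in total: if just one vertex
-- u of a pair is missing, then either it has a neighbour outside the set to be matched with, or all
-- its neighbours are in the set and u is not needed. The result is a paired dominating set that is
-- no larger than D. If it is no smaller either, then every pair cost two vertices, so the whole
-- segment was added; as its ends lie outside the levels of A, a path vertex was gained.

open import Defs
open import Data.Nat using (ℕ; _≤_; _+_)
open import Data.Fin using (Fin)
open import Data.Fin.Subset using (Subset)
open import Data.Product using (Σ; _×_)

open import Data.Bool using (true)
open import Data.Bool.Properties using () renaming (_≟_ to _≟ᵇ_)
open import Data.Nat using (zero; suc; _*_; _⊓_; _∸_; _<_; z≤n; s≤s; s≤s⁻¹; ⌈_/2⌉; _≟_)
open import Data.Nat.Properties
open import Data.Fin.Properties using (any?; all?) renaming (_≟_ to _≟ᶠ_)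
open import Data.Fin.Subset
  using (_∈_; _∉_; _⊆_; _∪_; _─_; ⁅_⁆; ∣_∣; ⊥; inside; outside)
open import Data.Fin.Subset.Properties
open import Data.List using (List; []; _∷_; length; last; applyUpTo; allFin)
open import Data.List.Properties using (length-applyUpTo)
open import Data.List.Membership.Propositional using () renaming (_∈_ to _∈ₗ_)
open import Data.List.Membership.Propositional.Properties using (∈-allFin)
open import Data.List.Relation.Unary.Any using (here; there)
open import Data.List.Relation.Unary.Any.Properties using (applyUpTo⁻)
open import Data.List.Relation.Unary.Unique.Propositional.Properties using (applyUpTo⁺₁)
open import Data.Maybe using (just)
open import Data.Vec using (Vec; []; _∷_; here; there; lookup; tabulate)
open import Data.Vec.Properties using (lookup∘tabulate; lookup⇒[]=; []=⇒lookup)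
open import Data.Vec.Functional using (updateAt)
open import Data.Vec.Functional.Properties using (updateAt-updates; updateAt-minimal)
open import Data.Product using (∃; _,_; proj₁; proj₂)
open import Data.Sum using (_⊎_; inj₁; inj₂)
open import Data.Empty using (⊥-elim) renaming (⊥ to Void)
open import Function using (_∘_; const; id)
open import Relation.Nullary using (Dec; yes; no; does; contradiction)
open import Relation.Nullary.Decidable
  using (map′; _×-dec_; _⊎-dec_; _→-dec_; ¬?; dec-true; decidable-stable)
open import Relation.Unary using (Decidable)
open import Relation.Binary.PropositionalEquality
  using (_≡_; _≢_; refl; sym; trans; cong; cong₂; subst)

-- Minimisation and exhaustive search.

least : {P : ℕ → Set} → Decidable P → ∀ k → P k →
        ∃ λ m → P m × (∀ j → P j → m ≤ j)
least P? k pk with P? 0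
... | yes p0 = 0 , p0 , λ _ _ → z≤n
least P? zero    pk | no ¬p0 = contradiction pk ¬p0
least {P} P? (suc k) pk | no ¬p0 with least (P? ∘ suc) k pk
... | m , pm , min = suc m , pm , min′
  where
  min′ : ∀ j → P j → suc m ≤ j
  min′ zero    p0 = contradiction p0 ¬p0
  min′ (suc j) pj = s≤s (min j pj)

anyVec? : ∀ {m k} {P : Vec (Fin m) k → Set} → Decidable P → Dec (∃ P)
anyVec? {k = zero}  P? = map′ ([] ,_) (λ { ([] , p) → p }) (P? [])
anyVec? {k = suc k} P? =
  map′ (λ { (a , v , p) → (a ∷ v) , p }) (λ { ((a ∷ v) , p) → a , v , p })
       (any? λ a → anyVec? λ v → P? (a ∷ v))

-- Subsets can be searched, so the values of `μ` on `P` form a decidable set of naturals, and its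
-- least element is attained.
minimiser : ∀ {n} {P : Subset n → Set} → Decidable P → (μ : Subset n → ℕ) → ∃ P →
            ∃ λ D → P D × (∀ D′ → P D′ → μ D ≤ μ D′)
minimiser P? μ (D , pD)
  with least (λ k → anySubset? λ E → P? E ×-dec (μ E ≟ k)) (μ D) (D , pD , refl)
... | _ , (E , pE , refl) , min = E , pE , λ D′ pD′ → min (μ D′) (D′ , pD′ , refl)

-- Cardinalities of finite subsets.

module _ {n : ℕ} {P : Fin n → Set} (P? : Decidable P) where

  comprehension : Subset n
  comprehension = tabulate (does ∘ P?)

  ∈-comprehension⁺ : ∀ {x} → P x → x ∈ comprehension
  ∈-comprehension⁺ {x} px =
    lookup⇒[]= x _ (trans (lookup∘tabulate (does ∘ P?) x) (dec-true (P? x) px))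

  ∈-comprehension⁻ : ∀ {x} → x ∈ comprehension → P x
  ∈-comprehension⁻ {x} x∈ with P? x | trans (sym (lookup∘tabulate (does ∘ P?) x)) ([]=⇒lookup x∈)
  ... | yes px | _ = px
  ... | no _   | ()

∣p∪q∣≡∣p∣+∣q∣ : ∀ {n} (p q : Subset n) → (∀ {x} → x ∈ p → x ∉ q) → ∣ p ∪ q ∣ ≡ ∣ p ∣ + ∣ q ∣
∣p∪q∣≡∣p∣+∣q∣ []           []           _ = refl
∣p∪q∣≡∣p∣+∣q∣ (inside ∷ p)  (inside ∷ q)  d = ⊥-elim (d here here)
∣p∪q∣≡∣p∣+∣q∣ (inside ∷ p)  (outside ∷ q) d =
  cong suc (∣p∪q∣≡∣p∣+∣q∣ p q λ x∈p x∈q → d (there x∈p) (there x∈q))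
∣p∪q∣≡∣p∣+∣q∣ (outside ∷ p) (inside ∷ q)  d =
  trans (cong suc (∣p∪q∣≡∣p∣+∣q∣ p q λ x∈p x∈q → d (there x∈p) (there x∈q)))
        (sym (+-suc ∣ p ∣ ∣ q ∣))
∣p∪q∣≡∣p∣+∣q∣ (outside ∷ p) (outside ∷ q) d =
  ∣p∪q∣≡∣p∣+∣q∣ p q λ x∈p x∈q → d (there x∈p) (there x∈q)

x∈p─q⇒x∉q : ∀ {n} (p q : Subset n) {x} → x ∈ p ─ q → x ∉ q
x∈p─q⇒x∉q (_ ∷ p) (inside ∷ q)  ()        here
x∈p─q⇒x∉q (_ ∷ p) (_ ∷ q)       (there x∈) (there x∈q) = x∈p─q⇒x∉q p q x∈ x∈q

∣p∣≡∣p─q∣+∣q∣ : ∀ {n} {p q : Subset n} → q ⊆ p → ∣ p ∣ ≡ ∣ p ─ q ∣ + ∣ q ∣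
∣p∣≡∣p─q∣+∣q∣ {n} {p} {q} q⊆p =
  trans (cong ∣_∣ (⊆-antisym to from)) (∣p∪q∣≡∣p∣+∣q∣ (p ─ q) q (x∈p─q⇒x∉q p q))
  where
  to : p ⊆ (p ─ q) ∪ q
  to {x} x∈p with x ∈? q
  ... | yes x∈q = x∈p∪q⁺ (inj₂ x∈q)
  ... | no  x∉q = x∈p∪q⁺ (inj₁ (x∈p∧x∉q⇒x∈p─q x∈p x∉q))
  from : (p ─ q) ∪ q ⊆ p
  from x∈ with x∈p∪q⁻ (p ─ q) q x∈
  ... | inj₁ x∈p─q = p─q⊆p p q x∈p─q
  ... | inj₂ x∈q   = q⊆p x∈q

pair : ∀ {n} → Fin n → Fin n → Subset n
pair u v = ⁅ u ⁆ ∪ ⁅ v ⁆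

∈-pair⁻ : ∀ {n} {u v x : Fin n} → x ∈ pair u v → x ≡ u ⊎ x ≡ v
∈-pair⁻ {u = u} {v} x∈ with x∈p∪q⁻ ⁅ u ⁆ ⁅ v ⁆ x∈
... | inj₁ x∈u = inj₁ (x∈⁅y⁆⇒x≡y u x∈u)
... | inj₂ x∈v = inj₂ (x∈⁅y⁆⇒x≡y v x∈v)

u∈pair : ∀ {n} (u v : Fin n) → u ∈ pair u v
u∈pair u v = x∈p∪q⁺ (inj₁ (x∈⁅x⁆ u))

v∈pair : ∀ {n} (u v : Fin n) → v ∈ pair u v
v∈pair u v = x∈p∪q⁺ (inj₂ (x∈⁅x⁆ v))

∣pair∣≡2 : ∀ {n} {u v : Fin n} → u ≢ v → ∣ pair u v ∣ ≡ 2
∣pair∣≡2 {u = u} {v} u≢v =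
  trans (∣p∪q∣≡∣p∣+∣q∣ ⁅ u ⁆ ⁅ v ⁆ disjoint) (cong₂ _+_ (∣⁅x⁆∣≡1 u) (∣⁅x⁆∣≡1 v))
  where
  disjoint : ∀ {x} → x ∈ ⁅ u ⁆ → x ∉ ⁅ v ⁆
  disjoint x∈u x∈v = u≢v (trans (sym (x∈⁅y⁆⇒x≡y u x∈u)) (x∈⁅y⁆⇒x≡y v x∈v))

-- Removing `v` together with `m v` leaves a set of the same kind with two elements fewer. In
-- `cost≤` this parity pays for rounding an odd number of vertices up.
involution⇒even : ∀ {n} (m : Fin n → Fin n) (A : Subset n) →
                  (∀ v → v ∈ A → m v ∈ A × v ≢ m v × m (m v) ≡ v) →
                  ∃ λ h → ∣ A ∣ ≡ h + h
involution⇒even {n} m A₀ = go ∣ A₀ ∣ A₀ ≤-refl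
  where
  -- The recursion runs on a bound `k` for the cardinality, as `A ─ T` is not structurally smaller
  -- than `A`.
  go : ∀ k (A : Subset n) → ∣ A ∣ ≤ k → (∀ v → v ∈ A → m v ∈ A × v ≢ m v × m (m v) ≡ v) →
       ∃ λ h → ∣ A ∣ ≡ h + h
  go k A ∣A∣≤k inv with nonempty? A
  ... | no empty = 0 , trans (cong ∣_∣ (Empty-unique empty)) (∣⊥∣≡0 n)
  ... | yes (v , v∈A) with inv v v∈A
  ... | mv∈A , v≢mv , mmv≡v = helper k ∣A∣≤k
    where
    T = pair v (m v)
    T⊆A : T ⊆ A
    T⊆A x∈T with ∈-pair⁻ x∈T
    ... | inj₁ refl = v∈A
    ... | inj₂ refl = mv∈A
    ∣A∣≡ : ∣ A ∣ ≡ 2 + ∣ A ─ T ∣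
    ∣A∣≡ = trans (∣p∣≡∣p─q∣+∣q∣ T⊆A)
             (trans (cong (∣ A ─ T ∣ +_) (∣pair∣≡2 v≢mv)) (+-comm ∣ A ─ T ∣ 2))
    inv′ : ∀ w → w ∈ A ─ T → m w ∈ A ─ T × w ≢ m w × m (m w) ≡ w
    inv′ w w∈ with inv w (p─q⊆p A T w∈)
    ... | mw∈A , w≢mw , mmw≡w = x∈p∧x∉q⇒x∈p─q mw∈A mw∉T , w≢mw , mmw≡w
      where
      mw∉T : m w ∉ T
      mw∉T mw∈T with ∈-pair⁻ mw∈T
      ... | inj₁ mw≡v = x∈p─q⇒x∉q A T w∈
              (subst (_∈ T) (trans (cong m (sym mw≡v)) mmw≡w) (v∈pair v (m v)))
      ... | inj₂ mw≡mv = x∈p─q⇒x∉q A T w∈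
              (subst (_∈ T) (trans (sym mmv≡v) (trans (cong m (sym mw≡mv)) mmw≡w)) (u∈pair v (m v)))
    helper : ∀ k → ∣ A ∣ ≤ k → ∃ λ h → ∣ A ∣ ≡ h + h
    helper zero ∣A∣≤0 with subst (_≤ 0) ∣A∣≡ ∣A∣≤0
    ... | ()
    helper (suc k) ∣A∣≤k
      with go k (A ─ T) (≤-trans (n≤1+n _) (s≤s⁻¹ (subst (_≤ suc k) ∣A∣≡ ∣A∣≤k))) inv′
    ... | h , eq = suc h , trans ∣A∣≡ (cong suc (trans (cong suc eq) (sym (+-suc h h))))

-- Domination and matched extensions of a set.

module _ {n : ℕ} (G : Graph n) where

  open Graph G using (adj) renaming (sym to adj-sym; irrefl to adj-irrefl)

  Dominated : Subset n → Fin n → Set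
  Dominated D v = ∃ λ w → w ∈ D × InClosedNbhd G v w

  dominated-mono : ∀ {D E v} → D ⊆ E → Dominated D v → Dominated E v
  dominated-mono D⊆E (w , w∈D , nbr) = w , D⊆E w∈D , nbr

  nbhd-sym : ∀ {u v} → InClosedNbhd G u v → InClosedNbhd G v u
  nbhd-sym (inj₁ v≡u) = inj₁ (sym v≡u)
  nbhd-sym (inj₂ uv)  = inj₂ (adj-sym _ _ uv)

  -- `D` does all that `u` would do as a member of a dominating set, possibly without containing
  -- `u`.
  Dominates : Subset n → Fin n → Set
  Dominates D u = ∀ {v} → InClosedNbhd G u v → Dominated D v

  member-dominates : ∀ {D u} → u ∈ D → Dominates D u
  member-dominates {u = u} u∈D nbr = u , u∈D , nbhd-sym nbr

  adj⇒≢ : ∀ {u v} → Adj G u v → u ≢ v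
  adj⇒≢ uv refl = adj-irrefl _ uv

  dominated⇒dominating : ∀ {D} → (∀ v → Dominated D v) → Dominating G D
  dominated⇒dominating dom v v∉D with dom v
  ... | w , w∈D , inj₁ refl = contradiction w∈D v∉D
  ... | w , w∈D , inj₂ vw   = w , w∈D , vw

  dominating⇒dominated : ∀ {D} → Dominating G D → ∀ v → Dominated D v
  dominating⇒dominated {D} dom v with v ∈? D
  ... | yes v∈D = v , v∈D , inj₁ refl
  ... | no  v∉D with dom v v∉D
  ... | w , w∈D , vw = w , w∈D , inj₂ vw

  matching-∪-pair : ∀ {D u w} → HasPerfectMatching G D → u ∉ D → w ∉ D → Adj G u w →
                    HasPerfectMatching G (D ∪ pair u w)
  matching-∪-pair {D} {u} {w} (m , pm) u∉D w∉D uw = m′ , pm′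
    where
    m′ : Fin n → Fin n
    m′ = updateAt (updateAt m w (const u)) u (const w)
    m′u : m′ u ≡ w
    m′u = updateAt-updates u (updateAt m w (const u))
    m′w : m′ w ≡ u
    m′w = trans (updateAt-minimal w u _ (adj⇒≢ uw ∘ sym)) (updateAt-updates w m)
    m′z : ∀ {z} → z ∈ D → m′ z ≡ m z
    m′z {z} z∈D = trans (updateAt-minimal z u _ λ { refl → u∉D z∈D })
                        (updateAt-minimal z w m λ { refl → w∉D z∈D })
    pm′ : ∀ v → v ∈ D ∪ pair u w → m′ v ∈ D ∪ pair u w × Adj G v (m′ v) × m′ (m′ v) ≡ v
    pm′ v v∈ with x∈p∪q⁻ D (pair u w) v∈
    ... | inj₁ v∈D rewrite m′z v∈D with pm v v∈D
    ...   | mv∈D , vmv , mmv = x∈p∪q⁺ (inj₁ mv∈D) , vmv , trans (m′z mv∈D) mmv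
    pm′ v v∈ | inj₂ v∈pair′ with ∈-pair⁻ v∈pair′
    ...   | inj₁ refl rewrite m′u = x∈p∪q⁺ (inj₂ (v∈pair u w)) , uw , m′w
    ...   | inj₂ refl rewrite m′w = x∈p∪q⁺ (inj₂ (u∈pair u w)) , adj-sym _ _ uw , m′u

  -- Either something was saved, or every requested vertex was really taken in. The second
  -- alternative is what later yields a new path vertex when the cardinality does not drop.
  WithinBudget : Subset n → (Fin n → Set) → ℕ → Subset n → Set
  WithinBudget D Q c E = ∣ E ∣ < ∣ D ∣ + c ⊎ (∣ E ∣ ≤ ∣ D ∣ + c × (∀ {u} → Q u → u ∈ E))

  -- `Q` collects the vertices whose effect is requested, and `c` is the number of new elements
  -- allowed for them.
  record Extension (D : Subset n) (Q : Fin n → Set) (c : ℕ) : Set where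
    field
      set       : Subset n
      extends   : D ⊆ set
      matched   : HasPerfectMatching G set
      dominates : ∀ {u} → Q u → Dominates set u
      size      : WithinBudget D Q c set

    size≤ : ∣ set ∣ ≤ ∣ D ∣ + c
    size≤ with size
    ... | inj₁ lt       = <⇒≤ lt
    ... | inj₂ (le , _) = le

  open Extension

  no-extension : ∀ {D} → HasPerfectMatching G D → Extension D (λ _ → Void) 0
  no-extension {D} pm = record
    { set = D ; extends = id ; matched = pm ; dominates = λ ()
    ; size = inj₂ (≤-reflexive (sym (+-identityʳ _)) , λ ()) }

  -- A request for a vertex already in `D` is free: the extension contains it, so both alternatives
  -- of the budget carry over.
  absorb : ∀ {D Q Q′ c} → (∀ {u} → Q′ u → Q u ⊎ u ∈ D) → Extension D Q c → Extension D Q′ c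
  absorb {D} {Q} {Q′} {c} split e = record
    { set = set e ; extends = extends e ; matched = matched e
    ; dominates = dom ; size = sz (size e) }
    where
    dom : ∀ {u} → Q′ u → Dominates (set e) u
    dom q′ with split q′
    ... | inj₁ q   = dominates e q
    ... | inj₂ u∈D = member-dominates (extends e u∈D)
    sz : WithinBudget D Q c (set e) → WithinBudget D Q′ c (set e)
    sz (inj₁ lt) = inj₁ lt
    sz (inj₂ (le , all)) = inj₂ (le , λ {u} → mem {u})
      where
      mem : ∀ {u} → Q′ u → u ∈ set e
      mem q′ with split q′
      ... | inj₁ q   = all q
      ... | inj₂ u∈D = extends e u∈D

  -- A saving in one step cannot be lost in the other, which stays within its own allowance; without
  -- any saving, both steps took in all their vertices.
  compose : ∀ {D Q₁ Q₂ c₁ c₂} (e : Extension D Q₁ c₁) → Extension (set e) Q₂ c₂ →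
            Extension D (λ u → Q₁ u ⊎ Q₂ u) (c₁ + c₂)
  compose {D} {Q₁} {Q₂} {c₁} {c₂} e f = record
    { set = set f ; extends = extends f ∘ extends e ; matched = matched f
    ; dominates = dom ; size = sz (size e) (size f) }
    where
    dom : ∀ {u} → Q₁ u ⊎ Q₂ u → Dominates (set f) u
    dom (inj₁ q₁) nbr = dominated-mono (extends f) (dominates e q₁ nbr)
    dom (inj₂ q₂) = dominates f q₂
    assoc : ∣ D ∣ + c₁ + c₂ ≡ ∣ D ∣ + (c₁ + c₂)
    assoc = +-assoc ∣ D ∣ c₁ c₂
    sz : WithinBudget D Q₁ c₁ (set e) → WithinBudget (set e) Q₂ c₂ (set f) →
         WithinBudget D (λ u → Q₁ u ⊎ Q₂ u) (c₁ + c₂) (set f)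
    sz (inj₁ lt) _ = inj₁ (subst (∣ set f ∣ <_) assoc (≤-<-trans (size≤ f) (+-monoˡ-< c₂ lt)))
    sz (inj₂ (le , _)) (inj₁ lt) =
      inj₁ (subst (∣ set f ∣ <_) assoc (<-≤-trans lt (+-monoˡ-≤ c₂ le)))
    sz (inj₂ (le , all₁)) (inj₂ (le′ , all₂)) =
      inj₂ (subst (∣ set f ∣ ≤_) assoc (≤-trans le′ (+-monoˡ-≤ c₂ le)) ,
            λ { (inj₁ q₁) → extends f (all₁ q₁) ; (inj₂ q₂) → all₂ q₂ })

  add-pair : ∀ {D u w} → HasPerfectMatching G D → u ∉ D → w ∉ D → Adj G u w →
             Extension D (λ z → z ≡ u ⊎ z ≡ w) 2
  add-pair {D} {u} {w} pm u∉D w∉D uw = record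
    { set = D ∪ pair u w ; extends = p⊆p∪q (pair u w) ; matched = matching-∪-pair pm u∉D w∉D uw
    ; dominates = λ q → member-dominates (mem q) ; size = inj₂ (≤-reflexive ∣∣≡ , mem) }
    where
    mem : ∀ {z} → z ≡ u ⊎ z ≡ w → z ∈ D ∪ pair u w
    mem (inj₁ refl) = x∈p∪q⁺ (inj₂ (u∈pair u w))
    mem (inj₂ refl) = x∈p∪q⁺ (inj₂ (v∈pair u w))
    disjoint : ∀ {x} → x ∈ D → x ∉ pair u w
    disjoint x∈D x∈T with ∈-pair⁻ x∈T
    ... | inj₁ refl = u∉D x∈D
    ... | inj₂ refl = w∉D x∈D
    ∣∣≡ : ∣ D ∪ pair u w ∣ ≡ ∣ D ∣ + 2
    ∣∣≡ = trans (∣p∪q∣≡∣p∣+∣q∣ D (pair u w) disjoint) (cong (∣ D ∣ +_) (∣pair∣≡2 (adj⇒≢ uw)))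

  adj? : ∀ u v → Dec (Adj G u v)
  adj? u v = adj u v ≟ᵇ true

  -- Decidability makes the choice of a minimal paired dominating set constructive.
  pairedDominating? : Decidable (PairedDominating G)
  pairedDominating? D = dominating? ×-dec matching?
    where
    dominating? : Dec (Dominating G D)
    dominating? = all? λ v → ¬? (v ∈? D) →-dec any? λ u → (u ∈? D) ×-dec adj? v u
    IsMatching : (Fin n → Fin n) → Set
    IsMatching m = ∀ v → v ∈ D → (m v ∈ D) × Adj G v (m v) × (m (m v) ≡ v)
    isMatching? : Decidable IsMatching
    isMatching? m = all? λ v → (v ∈? D) →-dec
      ((m v ∈? D) ×-dec adj? v (m v) ×-dec (m (m v) ≟ᶠ v))
    matching? : Dec (HasPerfectMatching G D)
    -- A matching is a function on a finite set and is searched for through its table of values.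
    matching? = map′ (λ { (ms , pm) → lookup ms , pm }) from
                     (anyVec? λ ms → isMatching? (lookup ms))
      where
      from : HasPerfectMatching G D → ∃ λ ms → IsMatching (lookup ms)
      from (m , pm) = tabulate m , pm′
        where
        pm′ : IsMatching (lookup (tabulate m))
        pm′ v v∈D rewrite lookup∘tabulate m v | lookup∘tabulate m (m v) = pm v v∈D

  module _ (noIsolated : NoIsolated G) where

    -- Two elements are spent only if `u` enters together with a new partner; otherwise nothing is
    -- spent, which is a strict saving.
    extend-by-vertex : ∀ {D} u → HasPerfectMatching G D → Extension D (_≡ u) 2
    extend-by-vertex {D} u pm with u ∈? D
    ... | yes u∈D = record
      { set = D ; extends = id ; matched = pm
      ; dominates = λ { refl → member-dominates u∈D }
      ; size = inj₁ (m<m+n ∣ D ∣ (s≤s z≤n)) }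
    ... | no u∉D with any? (λ w → adj? u w ×-dec ¬? (w ∈? D))
    ... | yes (w , uw , w∉D) = absorb (λ z≡u → inj₁ (inj₁ z≡u)) (add-pair pm u∉D w∉D uw)
    -- All neighbours of `u` lie in `D` and dominate themselves, and one of them, which exists as
    -- `u` is not isolated, dominates `u`.
    ... | no none = record
      { set = D ; extends = id ; matched = pm
      ; dominates = λ { refl → dom }
      ; size = inj₁ (m<m+n ∣ D ∣ (s≤s z≤n)) }
      where
      nbrs⊆D : ∀ {w} → Adj G u w → w ∈ D
      nbrs⊆D {w} uw = decidable-stable (w ∈? D) λ w∉D → none (w , uw , w∉D)
      dom : Dominates D u
      dom (inj₁ refl) with noIsolated u
      ... | w , uw = w , nbrs⊆D uw , inj₂ uw
      dom (inj₂ uv) = _ , nbrs⊆D uv , inj₁ refl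

    -- The allowance is that of a single vertex: if both ends are missing they are matched to each
    -- other, and otherwise at most one needs attention.
    extend-by-edge : ∀ {D u v} → Adj G u v → HasPerfectMatching G D →
                     Extension D (λ z → z ≡ u ⊎ z ≡ v) 2
    extend-by-edge {D} {u} {v} uv pm with u ∈? D | v ∈? D
    ... | yes u∈D | _ =
      absorb (λ { (inj₁ refl) → inj₂ u∈D ; (inj₂ eq) → inj₁ eq }) (extend-by-vertex v pm)
    ... | no _ | yes v∈D =
      absorb (λ { (inj₁ eq) → inj₁ eq ; (inj₂ refl) → inj₂ v∈D }) (extend-by-vertex u pm)
    ... | no u∉D | no v∉D = add-pair pm u∉D v∉D uv

    Range : (ℕ → Fin n) → ℕ → Fin n → Set
    Range g q u = ∃ λ t → t < q × u ≡ g t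

    -- The walk is cut into consecutive edges. A last vertex left over when `q` is odd is allowed
    -- two elements of its own, hence the rounding up.
    extend-by-walk : ∀ {D} q (g : ℕ → Fin n) → (∀ t → suc t < q → Adj G (g t) (g (suc t))) →
                     HasPerfectMatching G D → Extension D (Range g q) (⌈ q /2⌉ * 2)
    extend-by-walk zero g walk pm = absorb (λ { (_ , () , _) }) (no-extension pm)
    extend-by-walk (suc zero) g walk pm =
      absorb (λ { (zero , _ , eq) → inj₁ eq ; (suc _ , s≤s () , _) }) (extend-by-vertex (g 0) pm)
    extend-by-walk (suc (suc q)) g walk pm = absorb split (compose e
        (extend-by-walk q (g ∘ suc ∘ suc) (λ t lt → walk (suc (suc t)) (s≤s (s≤s lt))) (matched e)))
      where
      e = extend-by-edge (walk 0 (s≤s (s≤s z≤n))) pm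
      split : ∀ {u} → Range g (suc (suc q)) u →
              ((u ≡ g 0 ⊎ u ≡ g 1) ⊎ Range (g ∘ suc ∘ suc) q u) ⊎ u ∈ _
      split (zero , _ , eq) = inj₁ (inj₁ (inj₁ eq))
      split (suc zero , _ , eq) = inj₁ (inj₁ (inj₂ eq))
      split (suc (suc t) , s≤s (s≤s lt) , eq) = inj₁ (inj₂ (t , lt , eq))

    extend-by-list : ∀ {D} us → HasPerfectMatching G D → Extension D (_∈ₗ us) (length us * 2)
    extend-by-list [] pm = absorb (λ ()) (no-extension pm)
    extend-by-list (u ∷ us) pm =
      absorb (λ { (here eq) → inj₁ (inj₁ eq) ; (there u∈) → inj₁ (inj₂ u∈) })
             (compose e (extend-by-list us (matched e)))
      where e = extend-by-vertex u pm

    pairedDominating-exists : ∃ (PairedDominating G)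
    pairedDominating-exists = set e , dominated⇒dominating dom , matched e
      where
      -- The start is the empty set, for which any map is vacuously a perfect matching.
      e = extend-by-list (allFin n) (id , λ v v∈⊥ → contradiction v∈⊥ ∉⊥)
      dom : ∀ v → Dominated (set e) v
      dom v = dominates e (∈-allFin v) (inj₁ refl)

    -- The exchange along a dominating shortest path.

    module Exchange
      (lev : Fin n → ℕ) (f : ℕ → Fin n) (d : ℕ)
      (lev-adj : ∀ {u v} → Adj G u v → lev v ≤ suc (lev u))
      (lev-f : ∀ {k} → k ≤ d → lev (f k) ≡ k)
      (f-adj : ∀ {k} → k < d → Adj G (f k) (f (suc k)))
      (path-dominates : ∀ v → ∃ λ k → k ≤ d × InClosedNbhd G (f k) v)
      where

      lev-nbhd : ∀ {u v} → InClosedNbhd G u v → lev v ≤ suc (lev u)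
      lev-nbhd (inj₁ refl) = n≤1+n _
      lev-nbhd (inj₂ uv)   = lev-adj uv

      OnPath : Fin n → Set
      OnPath u = ∃ λ k → k < suc d × u ≡ f k

      onPath? : Decidable OnPath
      onPath? u = anyUpTo? (λ k → u ≟ᶠ f k) (suc d)

      path : Subset n
      path = comprehension onPath?

      f∈path : ∀ {k} → k ≤ d → f k ∈ path
      f∈path k≤d = ∈-comprehension⁺ onPath? (_ , s≤s k≤d , refl)

      -- Lexicographic: first the cardinality, then the number of path vertices missed.
      μ : Subset n → ℕ
      μ D = ∣ D ∣ * suc n + ∣ path ─ D ∣

      ∣∣<⇒μ< : ∀ {E D} → ∣ E ∣ < ∣ D ∣ → μ E < μ D
      ∣∣<⇒μ< {E} {D} lt = begin-strict
        -- At most `n` path vertices are missed, so with weight `suc n` a single element outweighs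
        -- them all.
        ∣ E ∣ * suc n + ∣ path ─ E ∣ <⟨ +-monoʳ-< (∣ E ∣ * suc n) (s≤s (∣p∣≤n (path ─ E))) ⟩
        ∣ E ∣ * suc n + suc n        ≡⟨ +-comm (∣ E ∣ * suc n) (suc n) ⟩
        suc ∣ E ∣ * suc n            ≤⟨ *-monoˡ-≤ (suc n) lt ⟩
        ∣ D ∣ * suc n                ≤⟨ m≤m+n _ _ ⟩
        μ D                          ∎
        where open ≤-Reasoning

      module _ {D : Subset n} (pd : PairedDominating G D) where

        m : Fin n → Fin n
        m = proj₁ (proj₂ pd)

        m-matches : ∀ v → v ∈ D → m v ∈ D × Adj G v (m v) × m (m v) ≡ v
        m-matches = proj₂ (proj₂ pd)

        Improvement : Set
        Improvement = ∃ λ E → PairedDominating G E × μ E < μ D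

        module _ (A : Subset n) (A⊆D : A ⊆ D) (closed : ∀ {v} → v ∈ A → m v ∈ A)
                 (a c : ℕ) (low : ∀ {v} → v ∈ A → a ≤ lev v)
                 (high : ∀ {v} → v ∈ A → lev v ≤ a + c) where

          ∣D∣≡ : ∣ D ∣ ≡ ∣ D ─ A ∣ + ∣ A ∣
          ∣D∣≡ = ∣p∣≡∣p─q∣+∣q∣ A⊆D

          matching-─ : HasPerfectMatching G (D ─ A)
          matching-─ = m , pm
            where
            pm : ∀ v → v ∈ D ─ A → m v ∈ D ─ A × Adj G v (m v) × m (m v) ≡ v
            pm v v∈ with m-matches v (p─q⊆p D A v∈)
            ... | mv∈D , vmv , mmv≡v = x∈p∧x∉q⇒x∈p─q mv∈D mv∉A , vmv , mmv≡v
              where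
              mv∉A : m v ∉ A
              mv∉A mv∈A = x∈p─q⇒x∉q D A v∈ (subst (_∈ A) mmv≡v (closed mv∈A))

          -- The segment from index a - 2 to a + c + 2, cut off at both ends of the path; writing
          -- `a ≤ 2 + k` avoids truncated subtraction.
          CoversSegment : (Fin n → Set) → Set
          CoversSegment Q = ∀ {k} → k ≤ d → a ≤ 2 + k → k ≤ 2 + (a + c) → Q (f k)

          -- A vertex dominated from outside `A` keeps its dominator. One dominated from `A` also
          -- has some `f k` in its closed neighbourhood; this is at most two edges from `A`, so `k`
          -- lies in the segment.
          extension-pairedDominating : ∀ {Q b} (e : Extension (D ─ A) Q b) → CoversSegment Q →
                                       PairedDominating G (set e)
          extension-pairedDominating e covers = dominated⇒dominating dom , matched e
            where
            dom : ∀ v → Dominated (set e) v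
            dom v with dominating⇒dominated (proj₁ pd) v
            ... | u , u∈D , vu with u ∈? A
            ... | no  u∉A = u , extends e (x∈p∧x∉q⇒x∈p─q u∈D u∉A) , vu
            ... | yes u∈A with path-dominates v
            ... | k , k≤d , kv = dominates e (covers k≤d a≤ k≤) kv
              where
              lev-v≤ : lev v ≤ suc k
              lev-v≤ = subst (λ t → lev v ≤ suc t) (lev-f k≤d) (lev-nbhd kv)
              k≤1+v : k ≤ suc (lev v)
              k≤1+v = subst (_≤ suc (lev v)) (lev-f k≤d) (lev-nbhd (nbhd-sym kv))
              a≤ : a ≤ 2 + k
              a≤ = ≤-trans (low u∈A) (≤-trans (lev-nbhd vu) (s≤s lev-v≤))
              k≤ : k ≤ 2 + (a + c)
              k≤ = ≤-trans k≤1+v (s≤s (≤-trans (lev-nbhd (nbhd-sym vu)) (s≤s (high u∈A))))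

          improve-strictly : ∀ {Q b} → Extension (D ─ A) Q b → CoversSegment Q → b < ∣ A ∣ →
                             Improvement
          improve-strictly e covers b<∣A∣ = set e , extension-pairedDominating e covers ,
            ∣∣<⇒μ< (subst (∣ set e ∣ <_) (sym ∣D∣≡)
                     (≤-<-trans (size≤ e) (+-monoʳ-< ∣ D ─ A ∣ b<∣A∣)))

          -- If something was saved, the cardinality drops. Otherwise the new set contains all of
          -- `Q`, in particular the path vertex `z` that `D` missed.
          improve-weakly : ∀ {Q b z} → Extension (D ─ A) Q b → CoversSegment Q → b ≤ ∣ A ∣ →
                           z ∈ path → z ∉ D → Q z → Improvement
          improve-weakly {Q} {b} {z} e covers b≤∣A∣ z∈path z∉D qz =
            set e , extension-pairedDominating e covers , decrease (size e)
            where
            budget : ∣ D ─ A ∣ + b ≤ ∣ D ∣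
            budget = subst (∣ D ─ A ∣ + b ≤_) (sym ∣D∣≡) (+-monoʳ-≤ ∣ D ─ A ∣ b≤∣A∣)
            decrease : WithinBudget (D ─ A) Q b (set e) → μ (set e) < μ D
            decrease (inj₁ lt) = ∣∣<⇒μ< (<-≤-trans lt budget)
            decrease (inj₂ (le , all)) =
              +-mono-≤-< (*-monoˡ-≤ (suc n) (≤-trans le budget)) (p⊂q⇒∣p∣<∣q∣ (missed⊆ ,
                z , x∈p∧x∉q⇒x∈p─q z∈path z∉D ,
                λ z∈ → x∈p─q⇒x∉q path (set e) z∈ (all qz)))
              where
              missed⊆ : path ─ set e ⊆ path ─ D
              -- No path vertex of `D` is lost: those in `A` have levels between `a` and `a + c`, so
              -- they belong to the segment, all of which was taken in.
              missed⊆ {v} v∈ = x∈p∧x∉q⇒x∈p─q v∈path v∉D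
                where
                v∈path = p─q⊆p path (set e) v∈
                v∉e = x∈p─q⇒x∉q path (set e) v∈
                v∉D : v ∉ D
                v∉D v∈D with v ∈? A
                ... | no v∉A = v∉e (extends e (x∈p∧x∉q⇒x∈p─q v∈D v∉A))
                ... | yes v∈A with ∈-comprehension⁻ onPath? v∈path
                ... | k , s≤s k≤d , refl = v∉e (all (covers k≤d
                  (≤-trans (subst (a ≤_) (lev-f k≤d) (low v∈A)) (m≤n+m k 2))
                  (≤-trans (subst (_≤ a + c) (lev-f k≤d) (high v∈A)) (m≤n+m (a + c) 2))))

          -- If g 0 and g 1 already lie in D, they need not be paid for; otherwise one is gained.
          improve-along : ∀ q (g : ℕ → Fin n) →
                          (∀ t → suc t < 2 + q → Adj G (g t) (g (suc t))) →
                          CoversSegment (Range g (2 + q)) → ⌈ 2 + q /2⌉ * 2 ≤ ∣ A ∣ →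
                          g 0 ∈ path → g 0 ∉ A → g 1 ∈ path → g 1 ∉ A → Improvement
          improve-along q g walk covers cost g0∈path g0∉A g1∈path g1∉A with g 0 ∈? D | g 1 ∈? D
          ... | no g0∉D | _ =
            improve-weakly (extend-by-walk (2 + q) g walk matching-─) covers cost
                           g0∈path g0∉D (0 , s≤s z≤n , refl)
          ... | yes _ | no g1∉D =
            improve-weakly (extend-by-walk (2 + q) g walk matching-─) covers cost
                           g1∈path g1∉D (1 , s≤s (s≤s z≤n) , refl)
          ... | yes g0∈D | yes g1∈D =
            improve-strictly (absorb split (extend-by-walk q (λ t → g (2 + t))
                               (λ t lt → walk (2 + t) (s≤s (s≤s lt))) matching-─))
                             covers (≤-trans (n≤1+n _) cost)
            where
            split : ∀ {u} → Range g (2 + q) u → Range (λ t → g (2 + t)) q u ⊎ u ∈ D ─ A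
            split (zero , _ , refl) = inj₂ (x∈p∧x∉q⇒x∈p─q g0∈D g0∉A)
            split (suc zero , _ , refl) = inj₂ (x∈p∧x∉q⇒x∈p─q g1∈D g1∉A)
            split (suc (suc t) , s≤s (s≤s lt) , eq) = inj₁ (t , lt , eq)

          even : ∃ λ h → ∣ A ∣ ≡ h + h
          even = involution⇒even m A λ v v∈A →
            closed v∈A , adj⇒≢ (proj₁ (proj₂ (m-matches v (A⊆D v∈A)))) ,
            proj₂ (proj₂ (m-matches v (A⊆D v∈A)))

          -- The left side is the least even number not below `q`, and `∣ A ∣` is even.
          cost≤ : ∀ {q} → q ≤ ∣ A ∣ → ⌈ q /2⌉ * 2 ≤ ∣ A ∣
          cost≤ {q} q≤ with even
          ... | h , eq rewrite eq = begin
            ⌈ q /2⌉ * 2     ≤⟨ *-monoˡ-≤ 2 (⌈n/2⌉-mono q≤) ⟩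
            ⌈ h + h /2⌉ * 2 ≡⟨ cong (_* 2) (sym (n≡⌈n+n/2⌉ h)) ⟩
            h * 2           ≡⟨ *-comm h 2 ⟩
            h + (h + 0)     ≡⟨ cong (h +_) (+-identityʳ h) ⟩
            h + h           ∎
            where open ≤-Reasoning

          f∉A-below : ∀ {k} → k ≤ d → k < a → f k ∉ A
          f∉A-below k≤d k<a fk∈A = <⇒≱ k<a (subst (a ≤_) (lev-f k≤d) (low fk∈A))

          f∉A-above : ∀ {k} → k ≤ d → a + c < k → f k ∉ A
          f∉A-above k≤d k> fk∈A = <⇒≱ k> (subst (_≤ a + c) (lev-f k≤d) (high fk∈A))

          large⇒nonempty : ∀ {k} → suc k ≤ ∣ A ∣ → ∃ (_∈ A)
          large⇒nonempty k< with nonempty? A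
          ... | yes v∈A = v∈A
          ... | no empty = contradiction
            (subst (_ ≤_) (trans (cong ∣_∣ (Empty-unique empty)) (∣⊥∣≡0 n)) k<) λ ()

          -- Any element of `A` is within one edge of the path, whose levels end at `d`. For `a` at
          -- least 2 this ensures that the vertices with indices a - 2 and a - 1 exist.
          a≤1+d : ∀ {k} → suc k ≤ ∣ A ∣ → a ≤ suc d
          a≤1+d k< with large⇒nonempty k<
          ... | v , v∈A with path-dominates v
          ... | k , k≤d , kv = ≤-trans (low v∈A) (≤-trans (lev-nbhd kv)
                                 (s≤s (subst (_≤ d) (sym (lev-f k≤d)) k≤d)))

          -- For a ≤ 1 the segment is cut off at x and may begin inside A, so it is traversed from
          -- its other end; if it is cut off at y as well, it has at most c + 3 vertices.
          improve-leftwards : a ≤ 1 → 2 + (a + c) ≤ d → 5 + c ≤ ∣ A ∣ → Improvement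
          improve-leftwards a≤1 e≤d large =
            improve-along (suc (a + c)) (λ t → f (e ∸ t)) walk covers
              (cost≤ (≤-trans (+-monoʳ-≤ 3 (+-monoˡ-≤ c a≤1)) (≤-trans (n≤1+n _) large)))
              (f∈path e≤d) (f∉A-above e≤d (s≤s (n≤1+n _)))
              (f∈path (<⇒≤ e≤d)) (f∉A-above (<⇒≤ e≤d) ≤-refl)
            where
            e = 2 + (a + c)
            walk : ∀ t → suc t < suc e → Adj G (f (e ∸ t)) (f (e ∸ suc t))
            walk t (s≤s t<e) = adj-sym _ _ (subst (λ k → Adj G (f (e ∸ suc t)) (f k))
              (sym (+-∸-assoc 1 t<e))
              (f-adj (<-≤-trans (∸-monoʳ-< (n<1+n t) t<e) (≤-trans (m∸n≤m e t) e≤d))))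
            covers : CoversSegment (Range (λ t → f (e ∸ t)) (suc e))
            covers {k} _ _ k≤e = e ∸ k , s≤s (m∸n≤m e k) , cong f (sym (m∸[m∸n]≡n k≤e))

          improve-entirely : a ≤ 1 → d < 2 + (a + c) → 5 + c ≤ ∣ A ∣ → Improvement
          improve-entirely a≤1 d<e large =
            improve-strictly (extend-by-walk (suc d) f (λ { t (s≤s lt) → f-adj lt }) matching-─)
              (λ {k} k≤d _ _ → k , s≤s k≤d , refl)
              -- Rounding up adds at most one, so at most `4 + c` elements are spent, fewer than
              -- `∣ A ∣` whatever its parity.
              (<-≤-trans (s≤s (≤-trans (round-up (suc d))
                                (≤-trans (s≤s d<e) (+-monoʳ-≤ 3 (+-monoˡ-≤ c a≤1)))))
                         large)
            where
            round-up : ∀ q → ⌈ q /2⌉ * 2 ≤ suc q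
            round-up zero = z≤n
            round-up (suc zero) = ≤-refl
            round-up (suc (suc q)) = s≤s (s≤s (round-up q))

          -- The first two vertices of the segment, with indices `a′` and `a′ + 1`, lie below all
          -- levels of `A`, so they can serve as `g 0` and `g 1`.
          improve-rightwards : ∀ a′ → a ≡ 2 + a′ → 5 + c ≤ ∣ A ∣ → Improvement
          improve-rightwards a′ refl large =
            improve-along r (λ t → f (a′ + t)) walk covers
              (cost≤ (≤-trans (s≤s (s≤s r≤)) large))
              (f∈path a′+0≤d)
              (f∉A-below a′+0≤d (s≤s (≤-trans (≤-reflexive (+-identityʳ a′)) (n≤1+n a′))))
              (f∈path a′+1≤d) (f∉A-below a′+1≤d (s≤s (≤-reflexive (+-comm a′ 1))))
            where
            -- `e` is the last index of the segment, either a + c + 2 or the end `d` of the path;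
            -- `r` counts its vertices after the first two.
            e r : ℕ
            e = d ⊓ (4 + a′ + c)
            r = e ∸ suc a′
            1+a′≤d : suc a′ ≤ d
            1+a′≤d = s≤s⁻¹ (a≤1+d large)
            a′+1≤d : a′ + 1 ≤ d
            a′+1≤d = subst (_≤ d) (+-comm 1 a′) 1+a′≤d
            a′+0≤d : a′ + 0 ≤ d
            a′+0≤d = subst (_≤ d) (sym (+-identityʳ a′)) (<⇒≤ 1+a′≤d)
            1+a′≤e : suc a′ ≤ e
            1+a′≤e = ⊓-glb 1+a′≤d (s≤s (≤-trans (m≤m+n a′ c) (m≤n+m (a′ + c) 3)))
            r≤ : r ≤ 3 + c
            r≤ = m≤n+o⇒m∸n≤o e (suc a′) (≤-trans (m⊓n≤n d (4 + a′ + c)) (≤-reflexive eq))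
              where
              eq : 4 + a′ + c ≡ suc a′ + (3 + c)
              eq = cong suc (trans (cong (_+ c) (+-comm 3 a′)) (+-assoc a′ 3 c))
            a′+1+r≡e : a′ + suc r ≡ e
            a′+1+r≡e = trans (+-suc a′ r) (m+[n∸m]≡n 1+a′≤e)
            walk : ∀ t → suc t < 2 + r → Adj G (f (a′ + t)) (f (a′ + suc t))
            walk t (s≤s t<1+r) = subst (λ k → Adj G (f (a′ + t)) (f k)) (sym (+-suc a′ t))
              (f-adj (<-≤-trans (+-monoʳ-< a′ t<1+r) (≤-trans (≤-reflexive a′+1+r≡e) (m⊓n≤m d _))))
            covers : CoversSegment (Range (λ t → f (a′ + t)) (2 + r))
            covers {k} k≤d (s≤s (s≤s a′≤k)) k≤ = k ∸ a′ , s≤s (m≤n+o⇒m∸n≤o k a′ k≤e) ,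
              cong f (sym (m+[n∸m]≡n a′≤k))
              where
              k≤e : k ≤ a′ + suc r
              k≤e = subst (k ≤_) (sym a′+1+r≡e) (⊓-glb k≤d k≤)

          -- The cases ask at which end the segment sticks out of the levels of `A` by two vertices:
          -- at its start, at its far end, or at neither for certain, when the whole path is short
          -- enough to be added.
          improve : 5 + c ≤ ∣ A ∣ → Improvement
          improve large with 2 ≤? a | 2 + (a + c) ≤? d
          ... | yes 2≤a | _ = improve-rightwards (a ∸ 2) (sym (m+[n∸m]≡n 2≤a)) large
          ... | no  2≰a | yes e≤d = improve-leftwards (s≤s⁻¹ (≰⇒> 2≰a)) e≤d large
          ... | no  2≰a | no  e≰d = improve-entirely (s≤s⁻¹ (≰⇒> 2≰a)) (≰⇒> e≰d) large

        -- Closing a crowded set under the matching.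

        module _ (S : Subset n) (S⊆D : S ⊆ D) (i j : ℕ)
                 (low : ∀ {v} → v ∈ S → i ≤ lev v) (high : ∀ {v} → v ∈ S → lev v ≤ i + j)
                 (large : 5 + j ≤ ∣ S ∣) where

          InClosure : Fin n → Set
          InClosure v = v ∈ D × (v ∈ S ⊎ m v ∈ S)

          inClosure? : Decidable InClosure
          inClosure? v = (v ∈? D) ×-dec ((v ∈? S) ⊎-dec (m v ∈? S))

          A : Subset n
          A = comprehension inClosure?

          A⊆D : A ⊆ D
          A⊆D v∈A = proj₁ (∈-comprehension⁻ inClosure? v∈A)

          S⊆A : S ⊆ A
          S⊆A v∈S = ∈-comprehension⁺ inClosure? (S⊆D v∈S , inj₁ v∈S)

          closed : ∀ {v} → v ∈ A → m v ∈ A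
          closed {v} v∈A with ∈-comprehension⁻ inClosure? v∈A
          ... | v∈D , inj₂ mv∈S = S⊆A mv∈S
          ... | v∈D , inj₁ v∈S with m-matches v v∈D
          ... | mv∈D , _ , mmv≡v =
            ∈-comprehension⁺ inClosure? (mv∈D , inj₂ (subst (_∈ S) (sym mmv≡v) v∈S))

          lowA : ∀ {v} → v ∈ A → i ≤ suc (lev v)
          lowA {v} v∈A with ∈-comprehension⁻ inClosure? v∈A
          ... | v∈D , inj₁ v∈S  = ≤-trans (low v∈S) (n≤1+n _)
          ... | v∈D , inj₂ mv∈S =
            ≤-trans (low mv∈S) (lev-adj (proj₁ (proj₂ (m-matches v v∈D))))

          highA : ∀ {v} → v ∈ A → lev v ≤ suc (i + j)
          highA {v} v∈A with ∈-comprehension⁻ inClosure? v∈A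
          ... | v∈D , inj₁ v∈S  = ≤-trans (high v∈S) (n≤1+n _)
          ... | v∈D , inj₂ mv∈S =
            ≤-trans (lev-adj (adj-sym _ _ (proj₁ (proj₂ (m-matches v v∈D))))) (s≤s (high mv∈S))

          ∪-⊆A : ∀ {T} → T ⊆ A → S ∪ T ⊆ A
          ∪-⊆A {T} T⊆A x∈ with x∈p∪q⁻ S T x∈
          ... | inj₁ x∈S = S⊆A x∈S
          ... | inj₂ x∈T = T⊆A x∈T

          -- `T` holds one witness for each of the `k` levels by which the range grows, so the
          -- surplus of five over the width is preserved.
          enlarge : ∀ {T k} → T ⊆ A → (∀ {x} → x ∈ T → x ∉ S) → ∣ T ∣ ≡ k → 5 + (k + j) ≤ ∣ A ∣
          enlarge {T} {k} T⊆A T∩S refl = begin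
            5 + (k + j)   ≡⟨ cong (5 +_) (+-comm k j) ⟩
            5 + j + k     ≤⟨ +-monoˡ-≤ k large ⟩
            ∣ S ∣ + ∣ T ∣ ≡⟨ sym (∣p∪q∣≡∣p∣+∣q∣ S T λ x∈S x∈T → T∩S x∈T x∈S) ⟩
            ∣ S ∪ T ∣     ≤⟨ p⊆q⇒∣p∣≤∣q∣ (∪-⊆A T⊆A) ⟩
            ∣ A ∣         ∎
            where open ≤-Reasoning

          singleton⊆ : ∀ {v} → v ∈ A → ⁅ v ⁆ ⊆ A
          singleton⊆ {v} v∈A x∈ with x∈⁅y⁆⇒x≡y v x∈
          ... | refl = v∈A

          singleton∩S : ∀ {v} → v ∉ S → ∀ {x} → x ∈ ⁅ v ⁆ → x ∉ S
          singleton∩S {v} v∉S x∈ with x∈⁅y⁆⇒x≡y v x∈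
          ... | refl = v∉S

          -- Partners are adjacent, so the closure reaches at most one level beyond the range on
          -- each side. A side is widened only if some element of `A` lies there, and that element
          -- is not in `S`.
          improve-crowded : Improvement
          improve-crowded with any? (λ v → (v ∈? A) ×-dec (lev v <? i))
                             | any? (λ v → (v ∈? A) ×-dec (i + j <? lev v))
          ... | no none | no none′ =
            improve A A⊆D closed i j (λ v∈A → ≮⇒≥ λ lt → none (_ , v∈A , lt))
              (λ v∈A → ≮⇒≥ λ lt → none′ (_ , v∈A , lt))
              (≤-trans large (p⊆q⇒∣p∣≤∣q∣ S⊆A))
          ... | no none | yes (w , w∈A , above) =
            improve A A⊆D closed i (suc j) (λ v∈A → ≮⇒≥ λ lt → none (_ , v∈A , lt))
              (λ v∈A → ≤-trans (highA v∈A) (≤-reflexive (sym (+-suc i j))))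
              (enlarge (singleton⊆ w∈A) (singleton∩S (λ w∈S → <⇒≱ above (high w∈S))) (∣⁅x⁆∣≡1 w))
          ... | yes (v , v∈A , below) | none = from-below i refl none
            where
            from-below : ∀ i′ → i ≡ i′ → Dec (∃ λ w → w ∈ A × i + j < lev w) → Improvement
            from-below zero refl _ = contradiction below λ ()
            from-below (suc i′) refl (no none′) =
              improve A A⊆D closed i′ (suc j) (λ u∈A → s≤s⁻¹ (lowA u∈A))
                (λ u∈A → ≤-trans (≮⇒≥ λ lt → none′ (_ , u∈A , lt)) (≤-reflexive (sym (+-suc i′ j))))
                (enlarge (singleton⊆ v∈A) (singleton∩S v∉S) (∣⁅x⁆∣≡1 v))
              where
              v∉S : v ∉ S
              v∉S v∈S = <⇒≱ below (low v∈S)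
            from-below (suc i′) refl (yes (w , w∈A , above)) =
              improve A A⊆D closed i′ (2 + j) (λ u∈A → s≤s⁻¹ (lowA u∈A))
                (λ u∈A → ≤-trans (highA u∈A)
                  (≤-reflexive (sym (trans (+-suc i′ (suc j)) (cong suc (+-suc i′ j))))))
                (enlarge pair⊆A pair∩S (∣pair∣≡2 v≢w))
              where
              v≢w : v ≢ w
              v≢w refl = <-asym (<-≤-trans below (m≤m+n i j)) above
              pair⊆A : pair v w ⊆ A
              pair⊆A x∈ with ∈-pair⁻ x∈
              ... | inj₁ refl = v∈A
              ... | inj₂ refl = w∈A
              pair∩S : ∀ {x} → x ∈ pair v w → x ∉ S
              pair∩S x∈ x∈S with ∈-pair⁻ x∈
              ... | inj₁ refl = <⇒≱ below (low x∈S)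
              ... | inj₂ refl = <⇒≱ above (high x∈S)

      -- A set minimising `μ` has minimum cardinality, since a smaller set would have smaller `μ`; a
      -- crowded range would give an improvement and contradict minimality.
      level-bounded-minimum : ∃ λ D → MinPairedDominating G D ×
        (∀ S → S ⊆ D → ∀ i j → (∀ {v} → v ∈ S → i ≤ lev v) → (∀ {v} → v ∈ S → lev v ≤ i + j) →
           ∣ S ∣ ≤ j + 4)
      level-bounded-minimum with minimiser pairedDominating? μ pairedDominating-exists
      ... | D , pd , min = D , (pd , λ E pdE → ≮⇒≥ λ lt → <⇒≱ (∣∣<⇒μ< lt) (min E pdE)) , bound
        where
        bound : ∀ S → S ⊆ D → ∀ i j → (∀ {v} → v ∈ S → i ≤ lev v) →
                (∀ {v} → v ∈ S → lev v ≤ i + j) → ∣ S ∣ ≤ j + 4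
        bound S S⊆D i j low high = ≮⇒≥ λ lt →
          let E , pdE , μE<μD = improve-crowded pd S S⊆D i j low high
                                  (subst (λ t → suc t ≤ ∣ S ∣) (+-comm j 4) lt)
          in <⇒≱ μE<μD (min E pdE)

  -- BFS levels and shortest paths.

  module Levels (connected : Connected G) (x : Fin n) where

    -- Walks of exactly `k` edges from `x`, repetitions allowed: these extend freely by an edge and
    -- are decidable by recursion, and the least such `k` is the distance.
    Reach : ℕ → Fin n → Set
    Reach zero    w = w ≡ x
    Reach (suc k) w = ∃ λ u → Reach k u × Adj G u w

    reach? : ∀ k → Decidable (Reach k)
    reach? zero    w = w ≟ᶠ x
    reach? (suc k) w = any? λ u → reach? k u ×-dec adj? u w

    reach-chain : ∀ {k a b} us → Reach k a → Chain G (a ∷ us) → last (a ∷ us) ≡ just b →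
                  Reach (length us + k) b
    reach-chain [] ra _ refl = ra
    reach-chain {k} {b = b} (u ∷ us) ra (au , ch) end =
      subst (λ t → Reach t b) (+-suc (length us) k) (reach-chain us (_ , ra , au) ch end)

    reach-path : ∀ {w} (p : Path G x w) → Reach (pathLength G p) w
    reach-path record { verts = a ∷ us ; start = refl ; end = end ; chain = ch } =
      subst (λ t → Reach t _) (+-identityʳ (length us)) (reach-chain us refl ch end)

    level : ∀ w → ∃ λ k → Reach k w × (∀ j → Reach j w → k ≤ j)
    level w = least (λ k → reach? k w) _ (reach-path (connected x w))

    lev : Fin n → ℕ
    lev w = proj₁ (level w)

    lev≤ : ∀ {k w} → Reach k w → lev w ≤ k
    lev≤ = proj₂ (proj₂ (level _)) _

    lev-adj : ∀ {u v} → Adj G u v → lev v ≤ suc (lev u)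
    lev-adj {u} uv = lev≤ (u , proj₁ (proj₂ (level u)) , uv)

    lev-0 : ∀ {w} → lev w ≡ 0 → w ≡ x
    lev-0 {w} eq = subst (λ k → Reach k w) eq (proj₁ (proj₂ (level w)))

    -- The last vertex but one of a shortest walk; a level below `k` there would put `w` below level
    -- `suc k`.
    parent : ∀ {k} w → lev w ≡ suc k → ∃ λ u → lev u ≡ k × Adj G u w
    parent {k} w eq with subst (λ t → Reach t w) eq (proj₁ (proj₂ (level w)))
    ... | u , ru , uw = u , ≤-antisym (lev≤ ru) (s≤s⁻¹ (subst (_≤ _) eq (lev-adj uw))) , uw

    -- `vertex` is total, but only its values up to `d` matter. Having one vertex per level makes
    -- the start `x` and excludes repetitions.
    record Geodesic (w : Fin n) (d : ℕ) : Set where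
      field
        vertex  : ℕ → Fin n
        end     : vertex d ≡ w
        lev-vertex : ∀ {k} → k ≤ d → lev (vertex k) ≡ k
        adjacent   : ∀ {k} → k < d → Adj G (vertex k) (vertex (suc k))

      vertices : List (Fin n)
      vertices = applyUpTo vertex (suc d)

      toPath : Path G x w
      toPath = record
        { verts = vertices
        ; start = cong just (lev-0 (lev-vertex z≤n))
        ; end = trans (last-applyUpTo vertex d) (cong just end)
        ; chain = chain-applyUpTo vertex d adjacent
        ; unique = applyUpTo⁺₁ vertex (suc d) λ i<j j<1+d eq → <⇒≢ i<j
            (trans (sym (lev-vertex (<⇒≤ (<-≤-trans i<j (s≤s⁻¹ j<1+d)))))
              (trans (cong lev eq) (lev-vertex (s≤s⁻¹ j<1+d)))) }
        where
        last-applyUpTo : ∀ (g : ℕ → Fin n) k → last (applyUpTo g (suc k)) ≡ just (g k)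
        last-applyUpTo g zero    = refl
        last-applyUpTo g (suc k) = last-applyUpTo (g ∘ suc) k
        chain-applyUpTo : ∀ (g : ℕ → Fin n) k → (∀ {t} → t < k → Adj G (g t) (g (suc t))) →
                          Chain G (applyUpTo g (suc k))
        chain-applyUpTo g zero    _  = _
        chain-applyUpTo g (suc k) ch = ch (s≤s z≤n) , chain-applyUpTo (g ∘ suc) k (ch ∘ s≤s)

      length-toPath : pathLength G toPath ≡ d
      length-toPath = length-applyUpTo (vertex ∘ suc) d

    geodesic : ∀ d w → lev w ≡ d → Geodesic w d
    geodesic zero w eq = record
      { vertex = const w ; end = refl ; lev-vertex = λ { z≤n → eq } ; adjacent = λ () }
    geodesic (suc d) w eq with parent w eq
    ... | u , lev-u , uw = record
      { vertex = vertex′ ; end = vertex′-last ; lev-vertex = lev-vertex′ ; adjacent = adjacent′ }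
      where
      open Geodesic (geodesic d u lev-u)
      vertex′ : ℕ → Fin n
      -- The geodesic to the parent is followed up to index `d`; every later index gets the value
      -- `w`.
      vertex′ k with k ≤? d
      ... | yes _ = vertex k
      ... | no  _ = w
      vertex′-last : vertex′ (suc d) ≡ w
      vertex′-last with suc d ≤? d
      ... | yes 1+d≤d = contradiction 1+d≤d 1+n≰n
      ... | no  _     = refl
      lev-vertex′ : ∀ {k} → k ≤ suc d → lev (vertex′ k) ≡ k
      lev-vertex′ {k} k≤1+d with k ≤? d
      ... | yes k≤d = lev-vertex k≤d
      ... | no  k≰d = trans eq (≤-antisym (≰⇒> k≰d) k≤1+d)
      adjacent′ : ∀ {k} → k < suc d → Adj G (vertex′ k) (vertex′ (suc k))
      adjacent′ {k} (s≤s k≤d) with k ≤? d | suc k ≤? d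
      ... | no  k≰d | _       = contradiction k≤d k≰d
      ... | yes _   | yes k<d = adjacent k<d
      ... | yes _   | no  k≮d =
        subst (λ v → Adj G v w) (trans (sym end) (cong vertex (≤-antisym (≮⇒≥ k≮d) k≤d))) uw

    -- A path is a walk, so its length is at least the level; conversely, the geodesic is a path
    -- whose length is the level.
    dist⇒lev : ∀ {w k} → Dist G x w k → lev w ≡ k
    dist⇒lev {w} ((p , len) , min) = ≤-antisym
      (subst (lev w ≤_) len (lev≤ (reach-path p)))
      (subst (_ ≤_) length-toPath (min toPath))
      where open Geodesic (geodesic (lev w) w refl)

theorem4 : ∀ {n : ℕ} (G : Graph n) → ATFree G → Connected G → NoIsolated G →
    ∀ (x y : Fin n) → DominatingPair G x y →
    ∀ (l : ℕ) → Ecc G x l →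
    Σ (Subset n) λ Dp → MinPairedDominating G Dp ×
    (∀ (i j : ℕ) → i + j ≤ l → LevelBound G x Dp i j (j + 4))
theorem4 {n} G _ connected noIsolated x y dominatingPair _ _ = D , minimum , levelBound
  where
  open Levels G connected x
  -- A shortest path from `x` to `y`, which dominates the graph because `x` and `y` form a
  -- dominating pair.
  open Geodesic (geodesic (lev y) y refl)
  path-dominates : ∀ v → ∃ λ k → k ≤ lev y × InClosedNbhd G (vertex k) v
  path-dominates v with dominatingPair toPath v
  ... | u , u∈ , vu with applyUpTo⁻ vertex u∈
  ... | k , s≤s k≤d , refl = k , k≤d , nbhd-sym G vu
  open Exchange G noIsolated lev vertex (lev y) lev-adj lev-vertex adjacent path-dominates
  D : Subset n
  D = proj₁ level-bounded-minimum
  minimum : MinPairedDominating G D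
  minimum = proj₁ (proj₂ level-bounded-minimum)
  levelBound : ∀ i j → i + j ≤ _ → LevelBound G x D i j (j + 4)
  levelBound i j _ S S⊆D within = proj₂ (proj₂ level-bounded-minimum) S S⊆D i j
    (λ v∈S → let k , dist , i≤k , _ = within _ v∈S in subst (i ≤_) (sym (dist⇒lev dist)) i≤k)
    (λ v∈S → let k , dist , _ , k≤ = within _ v∈S in subst (_≤ i + j) (sym (dist⇒lev dist)) k≤)
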